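{- Let $H$ be a graph with $\chi(H)=3$ that has a critical edge and contains a triangle. Then ${\delta_{\text{lin-rem}}}(H)\leq\frac13$.
   Context: Copies of $H$ are labeled copies. For $\varepsilon>0$ and $\gamma\in[0,1]$, $\delta(\varepsilon,H;\gamma)$ is the maximum $\delta\in[0,1]$ such that every $n$-vertex graph with minimum degree at least $\gamma n$ containing $\varepsilon n^2$ edge-disjoint copies of $H$ contains at least $\delta n^{v(H)}$ copies of $H$. ${\delta_{\text{lin-rem}}}(H)$ is the infimum of those $\gamma$ for which there is $\mu=\mu(\gamma)>0$ with $\delta(\varepsilon,H;\gamma)\geq\mu\varepsilon$ for all $\varepsilon>0$. An edge $xy$ of $H$ is critical if $\chi(H-xy)<\chi(H)$. -}

module Defs where

open import Data.Nat using (ℕ; zero; suc; _≤_; _<_; _^_)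
open import Data.Bool using (Bool; true; false; if_then_else_; T)
open import Data.Fin using (Fin)
open import Data.List using (List; length; map; allFin)
open import Data.Nat.ListAction using (sum)
open import Data.List.Relation.Unary.AllPairs using (AllPairs)
open import Data.Product using (Σ; ∃; ∃-syntax; _×_; proj₁)
open import Data.Sum using (_⊎_)
open import Data.Integer using (+_)
open import Data.Rational using (ℚ; _/_; _*_)
import Data.Rational as ℚ
open import Relation.Binary.PropositionalEquality using (_≡_; _≢_)
open import Relation.Nullary using (¬_)
open import Function.Definitions using (Injective)

record Graph (n : ℕ) : Set where
  field
    adj   : Fin n → Fin n → Bool
    sym   : ∀ x y → adj x y ≡ adj y x
    irrefl : ∀ x → adj x x ≡ false
open Graph public

Adj : ∀ {n} → Graph n → Fin n → Fin n → Set
Adj G x y = T (adj G x y)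

ℕ→ℚ : ℕ → ℚ
ℕ→ℚ n = (+ n) / 1

degree : ∀ {n} → Graph n → Fin n → ℕ
degree {n} G x = sum (map (λ y → if adj G x y then 1 else 0) (allFin n))

MinDegreeAtLeast : ∀ {n} → Graph n → ℚ → Set
MinDegreeAtLeast {n} G γ = ∀ x → γ * ℕ→ℚ n ℚ.≤ ℕ→ℚ (degree G x)

ColorableRel : ∀ {v} → (Fin v → Fin v → Set) → ℕ → Set
ColorableRel {v} R k = Σ (Fin v → Fin k) λ c → ∀ x y → R x y → c x ≢ c y

IsChromaticNumberRel : ∀ {v} → (Fin v → Fin v → Set) → ℕ → Set
IsChromaticNumberRel R k = ColorableRel R k × (∀ j → ColorableRel R j → k ≤ j)

IsChromaticNumber : ∀ {v} → Graph v → ℕ → Set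
IsChromaticNumber H k = IsChromaticNumberRel (Adj H) k

AdjMinusEdge : ∀ {v} → Graph v → Fin v → Fin v → Fin v → Fin v → Set
AdjMinusEdge H x y a b = Adj H a b × ¬ ((a ≡ x × b ≡ y) ⊎ (a ≡ y × b ≡ x))

CriticalEdge : ∀ {v} → Graph v → Fin v → Fin v → Set
CriticalEdge H x y =
  Adj H x y × Σ ℕ λ k → Σ ℕ λ j →
    IsChromaticNumber H k × IsChromaticNumberRel (AdjMinusEdge H x y) j × j < k

HasTriangle : ∀ {v} → Graph v → Set
HasTriangle H = ∃[ a ] ∃[ b ] ∃[ c ] (Adj H a b × Adj H b c × Adj H a c)

Copy : ∀ {v n} → Graph v → Graph n → Set
Copy {v} {n} H G = Σ (Fin v → Fin n) λ f → Injective _≡_ _≡_ f × (∀ a b → Adj H a b → Adj G (f a) (f b))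

DistinctCopies : ∀ {v n} {H : Graph v} {G : Graph n} → Copy H G → Copy H G → Set
DistinctCopies {v} f g = ¬ (∀ (a : Fin v) → proj₁ f a ≡ proj₁ g a)

EdgeDisjoint : ∀ {v n} {H : Graph v} {G : Graph n} → Copy H G → Copy H G → Set
EdgeDisjoint {v} {n} {H} f g =
  ¬ (∃[ a ] ∃[ b ] ∃[ c ] ∃[ d ] (Adj H a b × Adj H c d × proj₁ f a ≡ proj₁ g c × proj₁ f b ≡ proj₁ g d))

HasManyCopies : ∀ {v n} → Graph v → Graph n → ℚ → Set
HasManyCopies H G N = Σ (List (Copy H G)) λ cs → AllPairs (DistinctCopies {H = H} {G = G}) cs × N ℚ.≤ ℕ→ℚ (length cs)

HasManyEdgeDisjointCopies : ∀ {v n} → Graph v → Graph n → ℚ → Set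
HasManyEdgeDisjointCopies H G N = Σ (List (Copy H G)) λ cs → AllPairs (EdgeDisjoint {H = H} {G = G}) cs × N ℚ.≤ ℕ→ℚ (length cs)

-- μ > 0 witnesses δ(ε,H;γ) ≥ μ ε for all ε > 0: every n-vertex graph with minimum degree ≥ γ n
-- containing ε n² edge-disjoint copies of H contains at least μ ε n^{v(H)} copies of H.
LinearRemovalAt : ∀ {v} → Graph v → ℚ → ℚ → Set
LinearRemovalAt {v} H γ μ =
  ∀ (ε : ℚ) → ℚ.0ℚ ℚ.< ε → ∀ (n : ℕ) (G : Graph n) →
    MinDegreeAtLeast G γ →
    HasManyEdgeDisjointCopies H G (ε * ℕ→ℚ (n ^ 2)) →
    HasManyCopies H G (μ * ε * ℕ→ℚ (n ^ v))

-- γ lies in the set whose infimum is δ_lin-rem(H)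
LinearRemovalThreshold : ∀ {v} → Graph v → ℚ → Set
LinearRemovalThreshold H γ = Σ ℚ λ μ → ℚ.0ℚ ℚ.< μ × LinearRemovalAt H γ μ

-- δ_lin-rem(H) ≤ c  (infimum ≤ c; the set is upward closed in γ, so this says every γ > c is in it)
LinRemAtMost : ∀ {v} → Graph v → ℚ → Set
LinRemAtMost H c = ∀ (γ : ℚ) → c ℚ.< γ → LinearRemovalThreshold H γ

{-# OPTIONS --safe #-}
module Submission where

-- Since γ > 1/3, the degrees of the vertices of a triangle of G sum to more than (1 + c)n, so one of
-- its edges has linear codegree. Picking such an edge from a triangle of each of the εn² edge-disjoint
-- copies of H gives εn² distinct edges uw. As xy is critical and χ(H) = 3, the graph H - xy is
-- bipartite with x and y in one part. For each uw, the bipartite graph between the common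
-- neighbourhood of u and w (linear size) and V(G) is dense by the minimum degree, so convexity, applied
-- once for each part, yields Ω(n^(v(H)-2)) copies of H sending xy to uw.

open import Defs
open import Data.Bool using (Bool; true; false; if_then_else_; T; _∧_; _∨_; not)
open import Data.Bool.Properties using (∧-identityʳ; T-≡)
open import Data.Fin using (Fin; zero; suc; inject≤)
open import Data.Fin.Properties using (_≟_; inject≤-injective)
import Data.Integer as ℤ
import Data.Integer.Properties as ℤ
open import Data.List using (List; []; _∷_; length; map; concatMap; _++_; allFin)
open import Data.List.Properties using (map-++; map-tabulate; length-map; length-tabulate)
open import Data.List.Relation.Unary.All as All using (All; []; _∷_)
import Data.List.Relation.Unary.All.Properties as All
open import Data.List.Relation.Unary.AllPairs as AllPairs using (AllPairs; []; _∷_)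
import Data.List.Relation.Unary.AllPairs.Properties as AllPairs
open import Data.List.Relation.Unary.Unique.Propositional.Properties using (allFin⁺)
open import Data.Nat using (ℕ; zero; suc; _≤_; _<_; _^_; _+_; _*_; _∸_; z≤n; s≤s; s≤s⁻¹; >-nonZero)
open import Data.Nat.ListAction using (sum)
open import Data.Nat.ListAction.Properties using (sum-++)
open import Data.Nat.Properties hiding (_≟_)
open import Data.Nat.Tactic.RingSolver using (solve-∀)
open import Data.Product using (Σ; _×_; _,_; proj₁; proj₂; ∃-syntax)
open import Data.Rational using (ℚ; mkℚ; _/_)
import Data.Rational as ℚ
import Data.Rational.Properties as ℚ
import Data.Rational.Unnormalised as ℚᵘ
import Data.Rational.Unnormalised.Properties as ℚᵘ
open import Data.Sum as Sum using (_⊎_; inj₁; inj₂)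
open import Data.Vec.Functional using () renaming (_∷_ to _◂_)
open import Function using (_∘_; id; _on_; Equivalence)
open import Function.Definitions using (Injective)
open import Relation.Binary.PropositionalEquality hiding (sym)
import Relation.Binary.PropositionalEquality as ≡
open import Relation.Nullary using (¬_; does; yes; no; contradiction)
open import Relation.Nullary.Decidable using (_×-dec_; _⊎-dec_; dec-true)

-- Linearity in ε comes from fixing the edge: every edge of linear codegree carries a number of
-- copies whose constant depends on H and γ alone, and copies rooted at different edges differ, so
-- the counts add up. The obstacle is injectivity. Homomorphisms would be counted by plain power
-- means, but a copy uses distinct vertices, so each choice loses up to k = v + 2 candidates. The
-- truncated terms (d - k)^t still keep half of the average once n is large against k; this forces a
-- threshold n₀, below which another argument is required. All counting is done in ℕ with
-- denominators cleared: if γ has denominator q, a degree or codegree counts as linear when it is at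
-- least n / K with K = 3q.

private variable
  A B : Set
  m n : ℕ

-- Sums over lists and the power mean inequality

∑ : List A → (A → ℕ) → ℕ
∑ xs f = sum (map f xs)

∑-mono : ∀ (xs : List A) {f g : A → ℕ} → (∀ x → f x ≤ g x) → ∑ xs f ≤ ∑ xs g
∑-mono []       f≤g = z≤n
∑-mono (x ∷ xs) f≤g = +-mono-≤ (f≤g x) (∑-mono xs f≤g)

∑-cong : ∀ (xs : List A) {f g : A → ℕ} → (∀ x → f x ≡ g x) → ∑ xs f ≡ ∑ xs g
∑-cong []       f≡g = refl
∑-cong (x ∷ xs) f≡g = cong₂ _+_ (f≡g x) (∑-cong xs f≡g)

∑-+ : ∀ (xs : List A) (f g : A → ℕ) → ∑ xs (λ x → f x + g x) ≡ ∑ xs f + ∑ xs g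
∑-+ []       f g = refl
∑-+ (x ∷ xs) f g rewrite ∑-+ xs f g = interchange (f x) (g x) (∑ xs f) (∑ xs g)
  where
  interchange : ∀ a b c d → (a + b) + (c + d) ≡ (a + c) + (b + d)
  interchange = solve-∀

∑-*ˡ : ∀ (xs : List A) c (f : A → ℕ) → ∑ xs (λ x → c * f x) ≡ c * ∑ xs f
∑-*ˡ []       c f = ≡.sym (*-zeroʳ c)
∑-*ˡ (x ∷ xs) c f rewrite ∑-*ˡ xs c f = ≡.sym (*-distribˡ-+ c (f x) (∑ xs f))

∑-const : ∀ (xs : List A) c → ∑ xs (λ _ → c) ≡ length xs * c
∑-const []       c = refl
∑-const (x ∷ xs) c = cong (c +_) (∑-const xs c)

∑-zero : ∀ (xs : List A) → ∑ xs (λ _ → 0) ≡ 0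
∑-zero xs = trans (∑-const xs 0) (*-zeroʳ (length xs))

∑-swap : ∀ (xs : List A) (ys : List B) (f : A → B → ℕ) →
  ∑ xs (λ x → ∑ ys (f x)) ≡ ∑ ys (λ y → ∑ xs (λ x → f x y))
∑-swap []       ys f = ≡.sym (∑-zero ys)
∑-swap (x ∷ xs) ys f = trans (cong (∑ ys (f x) +_) (∑-swap xs ys f))
                             (≡.sym (∑-+ ys (f x) (λ y → ∑ xs (λ x′ → f x′ y))))

∑-++ : ∀ (xs ys : List A) (f : A → ℕ) → ∑ (xs ++ ys) f ≡ ∑ xs f + ∑ ys f
∑-++ xs ys f = trans (cong sum (map-++ f xs ys)) (sum-++ (map f xs) (map f ys))

∑-concatMap : ∀ (F : A → List B) (xs : List A) (f : B → ℕ) →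
  ∑ (concatMap F xs) f ≡ ∑ xs (λ x → ∑ (F x) f)
∑-concatMap F []       f = refl
∑-concatMap F (x ∷ xs) f = trans (∑-++ (F x) (concatMap F xs) f)
                                 (cong (∑ (F x) f +_) (∑-concatMap F xs f))

∑-map : ∀ (h : A → B) (xs : List A) (f : B → ℕ) → ∑ (map h xs) f ≡ ∑ xs (f ∘ h)
∑-map h []       f = refl
∑-map h (x ∷ xs) f = cong (f (h x) +_) (∑-map h xs f)

length≡∑1 : ∀ (xs : List A) → length xs ≡ ∑ xs (λ _ → 1)
length≡∑1 xs = ≡.sym (trans (∑-const xs 1) (*-identityʳ (length xs)))

∑-∸ : ∀ (xs : List A) (f : A → ℕ) k → ∑ xs f ≤ ∑ xs (λ x → f x ∸ k) + length xs * k
∑-∸ xs f k = ≤-trans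
  (∑-mono xs (λ x → m≤n+m∸n′ (f x)))
  (≤-reflexive (trans (∑-+ xs (λ x → f x ∸ k) (λ _ → k)) (cong (∑ xs (λ x → f x ∸ k) +_) (∑-const xs k))))
  where
  m≤n+m∸n′ : ∀ m → m ≤ m ∸ k + k
  m≤n+m∸n′ m = ≤-trans (m≤n+m∸n m k) (≤-reflexive (+-comm k (m ∸ k)))

2ab≤a²+b² : ∀ a b → 2 * (a * b) ≤ a * a + b * b
2ab≤a²+b² a b with ≤-total a b
... | inj₁ a≤b rewrite ≡.sym (m+[n∸m]≡n a≤b) = ≤-trans (m≤m+n _ _) (≤-reflexive (expand a (b ∸ a)))
  where
  expand : ∀ a d → 2 * (a * (a + d)) + d * d ≡ a * a + (a + d) * (a + d)
  expand = solve-∀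
... | inj₂ b≤a rewrite ≡.sym (m+[n∸m]≡n b≤a) = ≤-trans (m≤m+n _ _) (≤-reflexive (expand b (a ∸ b)))
  where
  expand : ∀ b d → 2 * ((b + d) * b) + d * d ≡ (b + d) * (b + d) + b * b
  expand = solve-∀

-- The tangent-line bound y^(t+1) ≥ a^(t+1) + (t+1) a^t (y - a), free of subtraction.
tangent : ∀ t a y → suc t * (a ^ t * y) ≤ y ^ suc t + t * a ^ suc t
tangent zero    a y = ≤-reflexive (base y)
  where
  base : ∀ y → y + 0 + 0 ≡ y * 1 + 0
  base = solve-∀
tangent (suc t) a y = +-cancelˡ-≤ (t * (a ^ suc t * y)) _ _ (begin
  t * (a ^ suc t * y) + suc (suc t) * (a ^ suc t * y)
    ≡⟨ lhs t (a ^ t) a y ⟩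
  suc t * a ^ t * (2 * (y * a))
    ≤⟨ *-monoʳ-≤ (suc t * a ^ t) (2ab≤a²+b² y a) ⟩
  suc t * a ^ t * (y * y + a * a)
    ≡⟨ mid t (a ^ t) a y ⟩
  y * (suc t * (a ^ t * y)) + suc t * a ^ suc (suc t)
    ≤⟨ +-monoˡ-≤ _ (*-monoʳ-≤ y (tangent t a y)) ⟩
  y * (y ^ suc t + t * a ^ suc t) + suc t * a ^ suc (suc t)
    ≡⟨ rhs t (a ^ t) a y (y ^ suc t) ⟩
  t * (a ^ suc t * y) + (y ^ suc (suc t) + suc t * a ^ suc (suc t)) ∎)
  where
  open ≤-Reasoning
  lhs : ∀ t p a y → t * (a * p * y) + suc (suc t) * (a * p * y) ≡ suc t * p * (2 * (y * a))
  lhs = solve-∀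
  mid : ∀ t p a y → suc t * p * (y * y + a * a) ≡ y * (suc t * (p * y)) + suc t * (a * (a * p))
  mid = solve-∀
  rhs : ∀ t p a y z → y * (z + t * (a * p)) + suc t * (a * (a * p)) ≡
                      t * (a * p * y) + (y * z + suc t * (a * (a * p)))
  rhs = solve-∀

-- Sum of the tangent bounds at `a`. Since `a` may be any natural lower bound of the mean, no
-- division occurs.
power-mean : ∀ (xs : List A) (f : A → ℕ) a t →
  length xs * a ≤ ∑ xs f → length xs * a ^ t ≤ ∑ xs (λ x → f x ^ t)
power-mean xs f a zero    _ = ≤-reflexive (≡.sym (∑-const xs 1))
power-mean xs f a (suc t) h = +-cancelʳ-≤ (ℓ * (t * a ^ suc t)) _ _ (begin
  ℓ * a ^ suc t + ℓ * (t * a ^ suc t)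
    ≡⟨ lhs ℓ t a (a ^ t) ⟩
  suc t * a ^ t * (ℓ * a)
    ≤⟨ *-monoʳ-≤ (suc t * a ^ t) h ⟩
  suc t * a ^ t * ∑ xs f
    ≡⟨ ≡.sym (∑-*ˡ xs (suc t * a ^ t) f) ⟩
  ∑ xs (λ x → suc t * a ^ t * f x)
    ≤⟨ ∑-mono xs (λ x → ≤-trans (≤-reflexive (*-assoc (suc t) (a ^ t) (f x))) (tangent t a (f x))) ⟩
  ∑ xs (λ x → f x ^ suc t + t * a ^ suc t)
    ≡⟨ ∑-+ xs (λ x → f x ^ suc t) (λ _ → t * a ^ suc t) ⟩
  ∑ xs (λ x → f x ^ suc t) + ∑ xs (λ _ → t * a ^ suc t)
    ≡⟨ cong (∑ xs (λ x → f x ^ suc t) +_) (∑-const xs _) ⟩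
  ∑ xs (λ x → f x ^ suc t) + ℓ * (t * a ^ suc t) ∎)
  where
  open ≤-Reasoning
  ℓ = length xs
  lhs : ∀ ℓ t a p → ℓ * (a * p) + ℓ * (t * (a * p)) ≡ suc t * p * (ℓ * a)
  lhs = solve-∀

-- Enumerating injective choices

ind : Bool → ℕ
ind b = if b then 1 else 0

size : (Fin n → Bool) → ℕ
size p = ∑ (allFin _) (ind ∘ p)

size-suc : (p : Fin (suc n) → Bool) → size p ≡ ind (p zero) + size (p ∘ suc)
size-suc {n} p = cong (λ xs → ind (p zero) + sum xs)
  (trans (map-tabulate suc (ind ∘ p)) (≡.sym (map-tabulate id (ind ∘ p ∘ suc))))

size-cong : {p r : Fin n → Bool} → (∀ a → p a ≡ r a) → size p ≡ size r
size-cong p≡r = ∑-cong (allFin _) (λ a → cong ind (p≡r a))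

ind≤1 : ∀ b → ind b ≤ 1
ind≤1 true  = ≤-refl
ind≤1 false = z≤n

length-allFin : ∀ n → length (allFin n) ≡ n
length-allFin n = length-tabulate {n = n} id

size≤n : (p : Fin n → Bool) → size p ≤ n
size≤n {n} p = ≤-trans (∑-mono (allFin n) (ind≤1 ∘ p))
  (≤-reflexive (trans (≡.sym (length≡∑1 (allFin n))) (length-allFin n)))

size-singleton : (b : Fin n) → size (λ a → does (a ≟ b)) ≡ 1
size-singleton {suc n} zero    = trans (size-suc {n} (λ a → does (a ≟ zero))) (cong suc (∑-zero (allFin n)))
size-singleton {suc n} (suc b) = trans (size-suc {n} (λ a → does (a ≟ suc b))) (size-singleton b)

fresh : Fin n → List (Fin n) → Bool
fresh a []       = true
fresh a (b ∷ bs) = not (does (a ≟ b)) ∧ fresh a bs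

size-fresh : (p : Fin n → Bool) (av : List (Fin n)) →
  size p ≤ size (λ a → p a ∧ fresh a av) + length av
size-fresh p []       = ≤-reflexive (trans (size-cong (λ a → ≡.sym (∧-identityʳ (p a)))) (≡.sym (+-identityʳ _)))
size-fresh {n} p (b ∷ bs) = begin
  size p
    ≤⟨ size-fresh p bs ⟩
  size (λ a → p a ∧ fresh a bs) + length bs
    ≤⟨ +-monoˡ-≤ (length bs) (∑-mono (allFin n) (λ a → split (p a) (does (a ≟ b)) (fresh a bs))) ⟩
  ∑ (allFin n) (λ a → ind (p a ∧ fresh a (b ∷ bs)) + ind (does (a ≟ b))) + length bs
    ≡⟨ cong (_+ length bs) (∑-+ (allFin n) (λ a → ind (p a ∧ fresh a (b ∷ bs))) _) ⟩
  size (λ a → p a ∧ fresh a (b ∷ bs)) + size (λ a → does (a ≟ b)) + length bs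
    ≡⟨ cong (λ s → size (λ a → p a ∧ fresh a (b ∷ bs)) + s + length bs) (size-singleton b) ⟩
  size (λ a → p a ∧ fresh a (b ∷ bs)) + 1 + length bs
    ≡⟨ +-assoc _ 1 (length bs) ⟩
  size (λ a → p a ∧ fresh a (b ∷ bs)) + suc (length bs) ∎
  where
  open ≤-Reasoning
  split : ∀ x y z → ind (x ∧ z) ≤ ind (x ∧ (not y ∧ z)) + ind y
  split false y     z = z≤n
  split true  true  z = ind≤1 z
  split true  false z = m≤m+n (ind z) 0

-- `fr` marks the coordinates to be chosen; the others are copied from `base`. Only `av` and earlier
-- choices are avoided, not the values of `base`: collisions with those are excluded later, by
-- adjacency or by listing them in `av`.
choose : (Fin m → Bool) → (Fin m → Fin n) → (Fin n → Bool) → List (Fin n) → List (Fin m → Fin n)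
choose {zero}  fr base q av = base ∷ []
choose {suc m} fr base q av with fr zero
... | false = map (base zero ◂_) (choose (fr ∘ suc) (base ∘ suc) q av)
... | true  = concatMap
  (λ a → if q a ∧ fresh a av then map (a ◂_) (choose (fr ∘ suc) (base ∘ suc) q (a ∷ av)) else [])
  (allFin _)

record Chosen (fr : Fin m → Bool) (base : Fin m → Fin n) (q : Fin n → Bool)
              (av : List (Fin n)) (f : Fin m → Fin n) : Set where
  field
    fixed     : ∀ i → fr i ≡ false → f i ≡ base i
    satisfies : ∀ i → fr i ≡ true → q (f i) ≡ true
    avoids    : ∀ i → fr i ≡ true → All (f i ≢_) av
    distinct  : ∀ i j → fr i ≡ true → fr j ≡ true → f i ≡ f j → i ≡ j
open Chosen public

fresh⇒All≢ : (a : Fin n) (av : List (Fin n)) → fresh a av ≡ true → All (a ≢_) av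
fresh⇒All≢ a []       _ = []
fresh⇒All≢ a (b ∷ bs) h with a ≟ b
... | no a≢b = a≢b ∷ fresh⇒All≢ a bs h

∧-true⁻ : ∀ x y → x ∧ y ≡ true → x ≡ true × y ≡ true
∧-true⁻ true true _ = refl , refl

All-concatMap : {R : A → Set} {P : B → Set} (F : A → List B) {xs : List A} →
  (∀ {x} → R x → All P (F x)) → All R xs → All P (concatMap F xs)
All-concatMap F h rs = All.concat⁺ (All.map⁺ (All.map h rs))

-- `Q` is the trace that a source leaves in the members of its block; `sep` compares traces to
-- separate members of different blocks.
AllPairs-concatMap : {S : B → B → Set} {R : A → A → Set} (Q : A → B → Set) (F : A → List B) (xs : List A) →
  (∀ x → All (Q x) (F x)) → (∀ x → AllPairs S (F x)) →
  (∀ {x y a b} → R x y → Q x a → Q y b → S a b) →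
  AllPairs R xs → AllPairs S (concatMap F xs)
AllPairs-concatMap Q F []       q s sep []       = []
AllPairs-concatMap {S = S} {R} Q F (x ∷ xs) q s sep (r ∷ rs) =
  AllPairs.++⁺ (s x) (AllPairs-concatMap Q F xs q s sep rs)
    (All.map (λ qa → All.concat⁺ (All.map⁺ (All.map (λ {y} rxy → All.map (sep rxy qa) (q y)) r))) (q x))

chosen : (fr : Fin m → Bool) (base : Fin m → Fin n) (q : Fin n → Bool) (av : List (Fin n)) →
  All (Chosen fr base q av) (choose fr base q av)
chosen {zero}  fr base q av = record
  { fixed = λ () ; satisfies = λ () ; avoids = λ () ; distinct = λ () } ∷ []
chosen {suc m} fr base q av with fr zero in eq
... | false = All.map⁺ (All.map extend (chosen (fr ∘ suc) (base ∘ suc) q av))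
  where
  absurd : ∀ {X : Set} → fr zero ≡ true → X
  absurd e with () ← trans (≡.sym eq) e
  extend : ∀ {f} → Chosen (fr ∘ suc) (base ∘ suc) q av f → Chosen fr base q av (base zero ◂ f)
  extend c = record
    { fixed     = λ { zero _ → refl ; (suc i) e → fixed c i e }
    ; satisfies = λ { zero e → absurd e ; (suc i) e → satisfies c i e }
    ; avoids    = λ { zero e → absurd e ; (suc i) e → avoids c i e }
    ; distinct  = λ { zero _ e → absurd e ; (suc _) zero _ e → absurd e
                    ; (suc i) (suc j) e e′ h → cong suc (distinct c i j e e′ h) } }
... | true  = All-concatMap _ id (All.universal branch (allFin _))
  where
  absurd : ∀ {X : Set} → fr zero ≡ false → X
  absurd e with () ← trans (≡.sym eq) e
  extend : ∀ a → q a ≡ true → fresh a av ≡ true →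
    ∀ {f} → Chosen (fr ∘ suc) (base ∘ suc) q (a ∷ av) f → Chosen fr base q av (a ◂ f)
  extend a qa fa {f} c = record
    { fixed     = λ { zero e → absurd e ; (suc i) e → fixed c i e }
    ; satisfies = λ { zero _ → qa ; (suc i) e → satisfies c i e }
    ; avoids    = λ { zero _ → fresh⇒All≢ a av fa ; (suc i) e → All.tail (avoids c i e) }
    ; distinct  = λ { zero zero _ _ _ → refl
                    ; zero (suc j) _ e h → contradiction (≡.sym h) (All.head (avoids c j e))
                    ; (suc i) zero e _ h → contradiction h (All.head (avoids c i e))
                    ; (suc i) (suc j) e e′ h → cong suc (distinct c i j e e′ h) } }
  branch : ∀ a → All (Chosen fr base q av)
    (if q a ∧ fresh a av then map (a ◂_) (choose (fr ∘ suc) (base ∘ suc) q (a ∷ av)) else [])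
  branch a with q a ∧ fresh a av in e
  ... | false = []
  ... | true  = All.map⁺ (All.map (extend a (proj₁ qf) (proj₂ qf)) (chosen (fr ∘ suc) (base ∘ suc) q (a ∷ av)))
    where qf = ∧-true⁻ (q a) (fresh a av) e

-- Difference on the free coordinates is the form that survives a second round of choices, which
-- overwrites other coordinates.
DifferOn : (Fin m → Bool) → (f g : Fin m → Fin n) → Set
DifferOn fr f g = ¬ (∀ i → fr i ≡ true → f i ≡ g i)

choose-differ : (fr : Fin m → Bool) (base : Fin m → Fin n) (q : Fin n → Bool) (av : List (Fin n)) →
  AllPairs (DifferOn fr) (choose fr base q av)
choose-differ {zero}  fr base q av = [] ∷ []
choose-differ {suc m} {n} fr base q av with fr zero in eq
... | false = AllPairs.map⁺ (AllPairs.map (λ d e → d (e ∘ suc)) (choose-differ (fr ∘ suc) (base ∘ suc) q av))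
... | true  = AllPairs-concatMap (λ a f → f zero ≡ a) _ (allFin n) head≡ branch
  (λ { a≢b refl refl e → a≢b (e zero eq) }) (allFin⁺ n)
  where
  rest : Fin n → List (Fin m → Fin n)
  rest a = choose (fr ∘ suc) (base ∘ suc) q (a ∷ av)
  head≡ : ∀ a → All (λ f → f zero ≡ a) (if q a ∧ fresh a av then map (a ◂_) (rest a) else [])
  head≡ a with q a ∧ fresh a av
  ... | false = []
  ... | true  = All.map⁺ (All.universal (λ _ → refl) (rest a))
  branch : ∀ a → AllPairs (DifferOn fr) (if q a ∧ fresh a av then map (a ◂_) (rest a) else [])
  branch a with q a ∧ fresh a av
  ... | false = []
  ... | true  = AllPairs.map⁺ (AllPairs.map (λ d e → d (e ∘ suc)) (choose-differ (fr ∘ suc) (base ∘ suc) q (a ∷ av)))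

-- Boolean-valued so that `ind` of it can be summed in a double count.
allOn : (Fin m → Bool) → (Fin n → Bool) → (Fin m → Fin n) → Bool
allOn {zero}  fr p f = true
allOn {suc m} fr p f = (not (fr zero) ∨ p (f zero)) ∧ allOn (fr ∘ suc) p (f ∘ suc)

allOn⁻ : (fr : Fin m → Bool) (p : Fin n → Bool) (f : Fin m → Fin n) →
  allOn fr p f ≡ true → ∀ i → fr i ≡ true → p (f i) ≡ true
allOn⁻ fr p f h zero    e with proj₁ (∧-true⁻ (not (fr zero) ∨ p (f zero)) _ h)
... | h₀ rewrite e = h₀
allOn⁻ fr p f h (suc i) e = allOn⁻ (fr ∘ suc) p (f ∘ suc) (proj₂ (∧-true⁻ (not (fr zero) ∨ p (f zero)) _ h)) i e

-- Freshness costs at most `length av` candidates at each free coordinate, so at least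
-- `size (q ∧ p) - k` remain, and these factors multiply. The bound on `k` persists because `av`
-- grows only when `m` shrinks. Keeping `p` apart from `q` lets one list serve all predicates `p`,
-- so that sums over the list and over `p` can be exchanged.
choose-lower : (fr : Fin m → Bool) (base : Fin m → Fin n) (q p : Fin n → Bool) (av : List (Fin n)) (k : ℕ) →
  length av + m ≤ k →
  (size (λ a → q a ∧ p a) ∸ k) ^ size fr ≤ ∑ (choose fr base q av) (λ f → ind (allOn fr p f))
choose-lower {zero}  fr base q p av k _ = ≤-refl
choose-lower {suc m} {n} fr base q p av k bound rewrite size-suc fr with fr zero
... | false = ≤-trans
  (choose-lower (fr ∘ suc) (base ∘ suc) q p av k (≤-trans (+-monoʳ-≤ (length av) (n≤1+n m)) bound))
  (≤-reflexive (≡.sym (∑-map (base zero ◂_) (choose (fr ∘ suc) (base ∘ suc) q av)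
    (λ f → ind (allOn (fr ∘ suc) p (f ∘ suc))))))
... | true  = begin
  (s ∸ k) * X
    ≤⟨ *-monoˡ-≤ X s∸k≤ ⟩
  size (λ a → (q a ∧ p a) ∧ fresh a av) * X
    ≡⟨ *-comm _ X ⟩
  X * size (λ a → (q a ∧ p a) ∧ fresh a av)
    ≡⟨ ≡.sym (∑-*ˡ (allFin n) X _) ⟩
  ∑ (allFin n) (λ a → X * ind ((q a ∧ p a) ∧ fresh a av))
    ≤⟨ ∑-mono (allFin n) branch ⟩
  ∑ (allFin n) (λ a → ∑ (F a) w)
    ≡⟨ ≡.sym (∑-concatMap F (allFin n) w) ⟩
  ∑ (concatMap F (allFin n)) w ∎
  where
  open ≤-Reasoning
  s = size (λ a → q a ∧ p a)
  X = (s ∸ k) ^ size (fr ∘ suc)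
  rest : Fin n → List (Fin m → Fin n)
  rest a = choose (fr ∘ suc) (base ∘ suc) q (a ∷ av)
  F : Fin n → List (Fin (suc m) → Fin n)
  F a = if q a ∧ fresh a av then map (a ◂_) (rest a) else []
  w : (Fin (suc m) → Fin n) → ℕ
  w f = ind (p (f zero) ∧ allOn (fr ∘ suc) p (f ∘ suc))
  s∸k≤ : s ∸ k ≤ size (λ a → (q a ∧ p a) ∧ fresh a av)
  s∸k≤ = ≤-trans
    (∸-mono (size-fresh (λ a → q a ∧ p a) av) (≤-trans (m≤m+n (length av) (suc m)) bound))
    (≤-reflexive (m+n∸n≡m _ (length av)))
  branch : ∀ a → X * ind ((q a ∧ p a) ∧ fresh a av) ≤ ∑ (F a) w
  branch a with q a | fresh a av | p a in pa
  ... | false | _     | _     = ≤-trans (≤-reflexive (*-zeroʳ X)) z≤n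
  ... | true  | false | false = ≤-trans (≤-reflexive (*-zeroʳ X)) z≤n
  ... | true  | false | true  = ≤-trans (≤-reflexive (*-zeroʳ X)) z≤n
  ... | true  | true  | false = ≤-trans (≤-reflexive (*-zeroʳ X)) z≤n
  ... | true  | true  | true  = begin
    X * 1
      ≡⟨ *-identityʳ X ⟩
    X
      ≤⟨ choose-lower (fr ∘ suc) (base ∘ suc) q p (a ∷ av) k (≤-trans (≤-reflexive (≡.sym (+-suc (length av) m))) bound) ⟩
    ∑ (rest a) (λ f → ind (allOn (fr ∘ suc) p f))
      ≡⟨ ∑-cong (rest a) (λ f → ≡.sym (cong (λ b → ind (b ∧ allOn (fr ∘ suc) p f)) pa)) ⟩
    ∑ (rest a) (λ f → w (a ◂ f))
      ≡⟨ ≡.sym (∑-map (a ◂_) (rest a) w) ⟩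
    ∑ (map (a ◂_) (rest a)) w ∎

length-choose≤ : (fr : Fin m → Bool) (base : Fin m → Fin n) (q : Fin n → Bool) (av : List (Fin n)) →
  length (choose fr base q av) ≤ n ^ size fr
length-choose≤ {zero}  fr base q av = ≤-refl
length-choose≤ {suc m} {n} fr base q av rewrite size-suc fr with fr zero
... | false = ≤-trans (≤-reflexive (length-map (base zero ◂_) (choose (fr ∘ suc) (base ∘ suc) q av)))
                      (length-choose≤ (fr ∘ suc) (base ∘ suc) q av)
... | true  = begin
  length (concatMap F (allFin n))
    ≡⟨ length≡∑1 (concatMap F (allFin n)) ⟩
  ∑ (concatMap F (allFin n)) (λ _ → 1)
    ≡⟨ ∑-concatMap F (allFin n) (λ _ → 1) ⟩
  ∑ (allFin n) (λ a → ∑ (F a) (λ _ → 1))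
    ≤⟨ ∑-mono (allFin n) branch ⟩
  ∑ (allFin n) (λ _ → n ^ size (fr ∘ suc))
    ≡⟨ trans (∑-const (allFin n) _) (cong (_* n ^ size (fr ∘ suc)) (length-allFin n)) ⟩
  n * n ^ size (fr ∘ suc) ∎
  where
  open ≤-Reasoning
  F : Fin n → List (Fin (suc m) → Fin n)
  F a = if q a ∧ fresh a av then map (a ◂_) (choose (fr ∘ suc) (base ∘ suc) q (a ∷ av)) else []
  branch : ∀ a → ∑ (F a) (λ _ → 1) ≤ n ^ size (fr ∘ suc)
  branch a with q a ∧ fresh a av
  ... | false = z≤n
  ... | true  = ≤-trans
    (≤-reflexive (trans (∑-map (a ◂_) rest (λ _ → 1)) (≡.sym (length≡∑1 rest))))
    (length-choose≤ (fr ∘ suc) (base ∘ suc) q (a ∷ av))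
    where rest = choose (fr ∘ suc) (base ∘ suc) q (a ∷ av)

-- Copies of H through a fixed edge

^-distribʳ-* : ∀ t a b → (a * b) ^ t ≡ a ^ t * b ^ t
^-distribʳ-* zero    a b = refl
^-distribʳ-* (suc t) a b = trans (cong (a * b *_) (^-distribʳ-* t a b)) (interchange a b (a ^ t) (b ^ t))
  where
  interchange : ∀ a b c d → a * b * (c * d) ≡ a * c * (b * d)
  interchange = solve-∀

-- Subtracting `k` from at most `M` terms costs at most kM, which is at most half of the guaranteed
-- total nM/R; hence the factor 2.
∑-∸-lower : ∀ (xs : List A) (f : A → ℕ) k n M R →
  length xs ≤ M → n * M ≤ R * ∑ xs f → 2 * R * k ≤ n →
  n * M ≤ 2 * R * ∑ xs (λ x → f x ∸ k)
∑-∸-lower xs f k n M R ℓ≤M avg k≤n = +-cancelʳ-≤ (n * M) _ _ (begin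
  n * M + n * M
    ≤⟨ +-mono-≤ avg avg ⟩
  R * ∑ xs f + R * ∑ xs f
    ≤⟨ +-mono-≤ (*-monoʳ-≤ R (∑-∸ xs f k)) (*-monoʳ-≤ R (∑-∸ xs f k)) ⟩
  R * (E + length xs * k) + R * (E + length xs * k)
    ≡⟨ regroup R E (length xs) k ⟩
  2 * R * E + 2 * R * k * length xs
    ≤⟨ +-monoʳ-≤ (2 * R * E) (*-mono-≤ k≤n ℓ≤M) ⟩
  2 * R * E + n * M ∎)
  where
  open ≤-Reasoning
  E = ∑ xs (λ x → f x ∸ k)
  regroup : ∀ R E ℓ k → R * (E + ℓ * k) + R * (E + ℓ * k) ≡ 2 * R * E + 2 * R * k * ℓ
  regroup = solve-∀

-- Scaling each term by 2R makes the natural number `n` a lower bound of the mean, as `power-mean`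
-- requires.
power-mean-∸ : ∀ (xs : List A) (f : A → ℕ) k n M R t →
  length xs ≤ M → n * M ≤ R * ∑ xs f → 2 * R * k ≤ n →
  length xs * n ^ t ≤ (2 * R) ^ t * ∑ xs (λ x → (f x ∸ k) ^ t)
power-mean-∸ xs f k n M R t ℓ≤M avg k≤n = begin
  length xs * n ^ t
    ≤⟨ power-mean xs (λ x → 2 * R * (f x ∸ k)) n t mean ⟩
  ∑ xs (λ x → (2 * R * (f x ∸ k)) ^ t)
    ≡⟨ ∑-cong xs (λ x → ^-distribʳ-* t (2 * R) (f x ∸ k)) ⟩
  ∑ xs (λ x → (2 * R) ^ t * (f x ∸ k) ^ t)
    ≡⟨ ∑-*ˡ xs ((2 * R) ^ t) (λ x → (f x ∸ k) ^ t) ⟩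
  (2 * R) ^ t * ∑ xs (λ x → (f x ∸ k) ^ t) ∎
  where
  open ≤-Reasoning
  mean : length xs * n ≤ ∑ xs (λ x → 2 * R * (f x ∸ k))
  mean = begin
    length xs * n                     ≤⟨ *-monoˡ-≤ n ℓ≤M ⟩
    M * n                             ≡⟨ *-comm M n ⟩
    n * M                             ≤⟨ ∑-∸-lower xs f k n M R ℓ≤M avg k≤n ⟩
    2 * R * ∑ xs (λ x → f x ∸ k)      ≡⟨ ≡.sym (∑-*ˡ xs (2 * R) (λ x → f x ∸ k)) ⟩
    ∑ xs (λ x → 2 * R * (f x ∸ k))    ∎

ind-∧ : ∀ b c → ind (b ∧ c) ≡ ind b * ind c
ind-∧ true  c = ≡.sym (+-identityʳ (ind c))
ind-∧ false c = refl

size-partition : {n : ℕ} (p r : Fin n → Bool) (x y : Fin n) →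
  (∀ i → ind (p i) + ind (r i) + ind (does (i ≟ x)) + ind (does (i ≟ y)) ≡ 1) →
  2 + (size p + size r) ≡ n
size-partition {n} p r x y one = begin
  2 + (size p + size r)
    ≡⟨ comm₂ (size p + size r) ⟩
  size p + size r + 1 + 1
    ≡⟨ ≡.sym (cong₂ (λ a b → size p + size r + a + b) (size-singleton x) (size-singleton y)) ⟩
  size p + size r + size (λ i → does (i ≟ x)) + size (λ i → does (i ≟ y))
    ≡⟨ ≡.sym (trans (∑-+ I (λ i → ind (p i) + ind (r i) + ind (does (i ≟ x))) (λ i → ind (does (i ≟ y))))
         (cong (_+ size (λ i → does (i ≟ y)))
           (trans (∑-+ I (λ i → ind (p i) + ind (r i)) (λ i → ind (does (i ≟ x))))
             (cong (_+ size (λ i → does (i ≟ x))) (∑-+ I (ind ∘ p) (ind ∘ r)))))) ⟩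
  ∑ I (λ i → ind (p i) + ind (r i) + ind (does (i ≟ x)) + ind (does (i ≟ y)))
    ≡⟨ ∑-cong I one ⟩
  ∑ I (λ _ → 1)
    ≡⟨ trans (≡.sym (length≡∑1 I)) (length-allFin n) ⟩
  n ∎
  where
  open ≡-Reasoning
  I = allFin n
  comm₂ : ∀ a → 2 + a ≡ a + 1 + 1
  comm₂ = solve-∀

codegree : Graph n → Fin n → Fin n → ℕ
codegree G u w = size (λ z → adj G u z ∧ adj G w z)

IsCopy : ∀ {v} → Graph v → Graph n → (Fin v → Fin n) → Set
IsCopy H G f = Injective _≡_ _≡_ f × (∀ a b → Adj H a b → Adj G (f a) (f b))

-- The shape of a 3-chromatic graph with critical edge xy: deleting xy leaves a bipartite graph with
-- x and y in the same part, and `side` is the other part.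
record NearBipartition {v} (H : Graph v) : Set where
  field
    x y    : Fin v
    side   : Fin v → Bool
    x≢y    : x ≢ y
    side-x : side x ≡ false
    side-y : side y ≡ false
    proper : ∀ a b → Adj H a b → ((a ≡ x × b ≡ y) ⊎ (a ≡ y × b ≡ x)) ⊎ side a ≢ side b

module Embeddings {v} {H : Graph v} (bip : NearBipartition H) where
  open NearBipartition bip

  other : Fin v → Bool
  other i = not (side i) ∧ (not (does (i ≟ x)) ∧ not (does (i ≟ y)))

  t s : ℕ
  t = size side
  s = size other

  data Class (i : Fin v) : Set where
    is-x    : i ≡ x → Class i
    is-y    : i ≡ y → Class i
    is-side : side i ≡ true → Class i
    is-rest : other i ≡ true → Class i

  classify : ∀ i → Class i
  classify i with side i in σ | i ≟ x in ex | i ≟ y in ey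
  ... | true  | _       | _       = is-side σ
  ... | false | yes i≡x | _       = is-x i≡x
  ... | false | no _    | yes i≡y = is-y i≡y
  ... | false | no _    | no _    = is-rest (cong₂ _∧_ (cong not σ) (cong₂ (λ a b → not (does a) ∧ not (does b)) ex ey))

  other-side : ∀ i → side i ≡ true → other i ≡ false
  other-side i σ rewrite σ = refl

  side-other : ∀ i → other i ≡ true → side i ≡ false
  side-other i o with side i
  ... | false = refl

  other-x : other x ≡ false
  other-x with x ≟ x
  ... | yes _  = cong (λ b → not b ∧ false) side-x
  ... | no x≢x = contradiction refl x≢x

  other-y : other y ≡ false
  other-y with y ≟ x | y ≟ y
  ... | yes _ | _      = cong (λ b → not b ∧ false) side-y
  ... | no _  | yes _  = cong (λ b → not b ∧ false) side-y
  ... | no _  | no y≢y = contradiction refl y≢y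

  2+[t+s]≡v : 2 + (t + s) ≡ v
  2+[t+s]≡v = size-partition side other x y one
    where
    one : ∀ i → ind (side i) + ind (other i) + ind (does (i ≟ x)) + ind (does (i ≟ y)) ≡ 1
    one i with side i in σ | i ≟ x | i ≟ y
    ... | true  | yes refl | _        with () ← trans (≡.sym σ) side-x
    ... | true  | no _     | yes refl with () ← trans (≡.sym σ) side-y
    ... | true  | no _     | no _     = refl
    ... | false | yes refl | yes x≡y  = contradiction x≡y x≢y
    ... | false | yes _    | no _     = refl
    ... | false | no _     | yes _    = refl
    ... | false | no _     | no _     = refl

  module At {n} (G : Graph n) (u w : Fin n) where

    -- Away from `x` and `y` the value is a placeholder: the first stage replaces it on `side`, the
    -- second on `other`.
    base : Fin v → Fin n
    base i = if does (i ≟ x) then u else w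

    common : Fin n → Bool
    common z = adj G u z ∧ adj G w z

    -- For fixed `g` these are the candidates for the remaining vertices; for fixed `a` the
    -- condition puts the image of `side` inside the neighbourhood of `a`. The double count in
    -- `joined-total` passes from one reading to the other.
    joined : (Fin v → Fin n) → Fin n → Bool
    joined g a = allOn side (adj G a) g

    sides : List (Fin v → Fin n)
    sides = choose side base common []

    completions : (Fin v → Fin n) → List (Fin v → Fin n)
    completions g = choose other g (joined g) (u ∷ w ∷ [])

    -- Copies with (x, y) ↦ (u, w): first the part opposite to x and y is placed inside the common
    -- neighbourhood of u and w, then the remaining vertices inside the common neighbourhood of that image.
    embeddings : List (Fin v → Fin n)
    embeddings = concatMap completions sides

    Anchored : (Fin v → Fin n) → Set
    Anchored f = f x ≡ u × f y ≡ w

    module _ (u~w : Adj G u w) {g f} (cg : Chosen side base common [] g)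
             (cf : Chosen other g (joined g) (u ∷ w ∷ []) f) where

      base-x : base x ≡ u
      base-x with x ≟ x
      ... | yes _  = refl
      ... | no x≢x = contradiction refl x≢x

      base-y : base y ≡ w
      base-y with y ≟ x
      ... | yes y≡x = contradiction (≡.sym y≡x) x≢y
      ... | no _    = refl

      f-x : f x ≡ u
      f-x = trans (fixed cf x other-x) (trans (fixed cg x side-x) base-x)

      f-y : f y ≡ w
      f-y = trans (fixed cf y other-y) (trans (fixed cg y side-y) base-y)

      f-side : ∀ i → side i ≡ true → f i ≡ g i
      f-side i σ = fixed cf i (other-side i σ)

      -- The image carries every edge between `side` and its complement, whether or not H has it.
      -- This yields both edge preservation and injectivity across the two parts.
      cross : ∀ i j → side i ≡ false → side j ≡ true → adj G (f i) (f j) ≡ true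
      cross i j σ τ with ∧-true⁻ (adj G u (g j)) (adj G w (g j)) (satisfies cg j τ) | classify i
      ... | u~g , _ | is-x refl rewrite f-x | f-side j τ = u~g
      ... | _ , w~g | is-y refl rewrite f-y | f-side j τ = w~g
      ... | _       | is-side σ′ with () ← trans (≡.sym σ) σ′
      ... | _       | is-rest o rewrite f-side j τ = allOn⁻ side (adj G (f i)) g (satisfies cf i o) j τ

      adjacent⇒≢ : ∀ {a b} → adj G a b ≡ true → a ≢ b
      adjacent⇒≢ {a} e refl with () ← trans (≡.sym e) (irrefl G a)

      u≢w : u ≢ w
      u≢w = adjacent⇒≢ (Equivalence.to T-≡ u~w)

      rest≢u : ∀ i → other i ≡ true → f i ≢ u
      rest≢u i o = All.head (avoids cf i o)

      rest≢w : ∀ i → other i ≡ true → f i ≢ w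
      rest≢w i o = All.head (All.tail (avoids cf i o))

      injective : Injective _≡_ _≡_ f
      injective {i} {j} e with classify i | classify j
      ... | is-x refl | is-x refl = refl
      ... | is-x refl | is-y refl = contradiction (trans (≡.sym f-x) (trans e f-y)) u≢w
      ... | is-x refl | is-side τ = contradiction e (adjacent⇒≢ (cross x j side-x τ))
      ... | is-x refl | is-rest o = contradiction (trans (≡.sym e) f-x) (rest≢u j o)
      ... | is-y refl | is-x refl = contradiction (trans (≡.sym f-x) (trans (≡.sym e) f-y)) u≢w
      ... | is-y refl | is-y refl = refl
      ... | is-y refl | is-side τ = contradiction e (adjacent⇒≢ (cross y j side-y τ))
      ... | is-y refl | is-rest o = contradiction (trans (≡.sym e) f-y) (rest≢w j o)
      ... | is-side σ | is-x refl = contradiction (≡.sym e) (adjacent⇒≢ (cross x i side-x σ))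
      ... | is-side σ | is-y refl = contradiction (≡.sym e) (adjacent⇒≢ (cross y i side-y σ))
      ... | is-side σ | is-side τ = distinct cg i j σ τ (trans (≡.sym (f-side i σ)) (trans e (f-side j τ)))
      ... | is-side σ | is-rest o = contradiction (≡.sym e) (adjacent⇒≢ (cross j i (side-other j o) σ))
      ... | is-rest o | is-x refl = contradiction (trans e f-x) (rest≢u i o)
      ... | is-rest o | is-y refl = contradiction (trans e f-y) (rest≢w i o)
      ... | is-rest o | is-side τ = contradiction e (adjacent⇒≢ (cross i j (side-other i o) τ))
      ... | is-rest o | is-rest o′ = distinct cf i j o o′ e

      homomorphism : ∀ a b → Adj H a b → Adj G (f a) (f b)
      homomorphism a b a~b with proper a b a~b
      ... | inj₁ (inj₁ (refl , refl)) rewrite f-x | f-y = u~w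
      ... | inj₁ (inj₂ (refl , refl)) rewrite f-x | f-y = subst T (sym G u w) u~w
      ... | inj₂ a≁b with side a in σ | side b in τ
      ...   | true  | true  = contradiction refl a≁b
      ...   | false | false = contradiction refl a≁b
      ...   | false | true  = Equivalence.from T-≡ (cross a b σ τ)
      ...   | true  | false = Equivalence.from T-≡ (trans (sym G (f a) (f b)) (cross b a τ σ))

    embeddings-valid : Adj G u w → All (λ f → IsCopy H G f × Anchored f) embeddings
    embeddings-valid u~w = All-concatMap completions
      (λ {g} cg → All.map (λ cf → ((λ {i} {j} → injective u~w cg cf {i} {j}) , homomorphism u~w cg cf)
                                , (f-x u~w cg cf , f-y u~w cg cf))
                          (chosen other g (joined g) (u ∷ w ∷ [])))
      (chosen side base common [])

    -- A completion of `g` agrees with `g` outside `other`, hence on `side`, where different first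
    -- stages differ. Completions of the same `g` differ on `other`.
    embeddings-differ : AllPairs (λ f g → ¬ (∀ i → f i ≡ g i)) embeddings
    embeddings-differ = AllPairs-concatMap (λ g f → ∀ i → other i ≡ false → f i ≡ g i) completions sides
      (λ g → All.map fixed (chosen other g (joined g) (u ∷ w ∷ [])))
      (λ g → AllPairs.map (λ d e → d (λ i _ → e i)) (choose-differ other g (joined g) (u ∷ w ∷ [])))
      (λ d qa qb e → d (λ i σ → trans (≡.sym (qa i (other-side i σ))) (trans (e i) (qb i (other-side i σ)))))
      (choose-differ side base common [])

    -- Bounds the avoided vertices in both stages: at most `v` choices, together with `u` and `w` in
    -- the second.
    k : ℕ
    k = 2 + v

    module _ (K : ℕ) (mindeg : ∀ z → n ≤ K * degree G z) (rich : n ≤ K * codegree G u w) where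

      Q : ℕ
      Q = (2 * (K * K)) ^ t

      -- Double count of the pairs (z, a) with z a common neighbour of `u` and `w` and a adjacent to
      -- z: there are at least n/K such z, each of degree at least n/K.
      common-degrees : n * n ≤ K * K * ∑ (allFin n) (λ a → size (λ z → common z ∧ adj G a z))
      common-degrees = begin
        n * n
          ≤⟨ *-monoʳ-≤ n rich ⟩
        n * (K * size common)
          ≡⟨ x*[y*z] n K (size common) ⟩
        K * (n * size common)
          ≡⟨ cong (K *_) (≡.sym (∑-*ˡ I n (ind ∘ common))) ⟩
        K * ∑ I (λ z → n * ind (common z))
          ≤⟨ *-monoʳ-≤ K (∑-mono I (λ z → *-monoˡ-≤ (ind (common z)) (mindeg z))) ⟩
        K * ∑ I (λ z → K * degree G z * ind (common z))
          ≡⟨ cong (K *_) (trans (∑-cong I (λ z → trans (*-assoc K _ _) (cong (K *_) (*-comm (degree G z) _)))) (∑-*ˡ I K _)) ⟩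
        K * (K * ∑ I (λ z → ind (common z) * degree G z))
          ≡⟨ ≡.sym (*-assoc K K _) ⟩
        K * K * ∑ I (λ z → ind (common z) * degree G z)
          ≡⟨ cong (K * K *_) (∑-cong I (λ z → trans (≡.sym (∑-*ˡ I (ind (common z)) _)) (∑-cong I (λ a →
               trans (≡.sym (ind-∧ (common z) (adj G z a))) (cong (λ b → ind (common z ∧ b)) (sym G z a)))))) ⟩
        K * K * ∑ I (λ z → ∑ I (λ a → ind (common z ∧ adj G a z)))
          ≡⟨ cong (K * K *_) (∑-swap I I _) ⟩
        K * K * ∑ I (λ a → size (λ z → common z ∧ adj G a z)) ∎
        where
        open ≤-Reasoning
        I = allFin n
        x*[y*z] : ∀ x y z → x * (y * z) ≡ y * (x * z)
        x*[y*z] = solve-∀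

      -- First use of convexity. A vertex `a` with d neighbours in the common neighbourhood is
      -- joined to at least (d - k)^t placements of `side`, and d averages at least n/K².
      joined-total : 2 * (K * K) * k ≤ n → n * n ^ t ≤ Q * ∑ sides (λ g → size (joined g))
      joined-total k≤n = begin
        n * n ^ t
          ≡⟨ cong (_* n ^ t) (≡.sym (length-allFin n)) ⟩
        length I * n ^ t
          ≤⟨ power-mean-∸ I (λ a → size (λ z → common z ∧ adj G a z)) k n n (K * K) t
               (≤-reflexive (length-allFin n)) common-degrees k≤n ⟩
        Q * ∑ I (λ a → (size (λ z → common z ∧ adj G a z) ∸ k) ^ t)
          ≤⟨ *-monoʳ-≤ Q (∑-mono I (λ a → choose-lower side base common (adj G a) [] k (m≤n+m v 2))) ⟩
        Q * ∑ I (λ a → ∑ sides (λ g → ind (joined g a)))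
          ≡⟨ cong (Q *_) (∑-swap I sides _) ⟩
        Q * ∑ sides (λ g → size (joined g)) ∎
        where
        open ≤-Reasoning
        I = allFin n

      completions-lower : ∀ g → (size (joined g) ∸ k) ^ s ≤ ∑ (completions g) (λ _ → 1)
      completions-lower g = ≤-trans
        (≤-reflexive (cong (λ c → (c ∸ k) ^ s) (size-cong (λ a → ≡.sym (∧-identityʳ (joined g a))))))
        -- The constantly true predicate makes the weighted sum a count of the completions.
        (≤-trans (choose-lower other g (joined g) (λ _ → true) (u ∷ w ∷ []) k ≤-refl)
                 (∑-mono (completions g) (λ f → ind≤1 (allOn other (λ _ → true) f))))

      -- Second use of convexity, now over the placements `g`: there are at most n^t of them, so by
      -- `joined-total` the mean of `size (joined g)` is at least n/Q.
      many-embeddings : 0 < n → 2 * (K * K) * k ≤ n → 2 * Q * k ≤ n →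
        n ^ (t + s) ≤ Q * (2 * Q) ^ s * length embeddings
      many-embeddings 0<n k≤n k≤n′ = begin
        n ^ (t + s)
          ≡⟨ ^-distribˡ-+-* n t s ⟩
        n ^ t * n ^ s
          ≤⟨ *-monoˡ-≤ (n ^ s) many-sides ⟩
        Q * ℓ * n ^ s
          ≡⟨ *-assoc Q ℓ (n ^ s) ⟩
        Q * (ℓ * n ^ s)
          ≤⟨ *-monoʳ-≤ Q (power-mean-∸ sides (λ g → size (joined g)) k n (n ^ t) Q s
               (length-choose≤ side base common []) (joined-total k≤n) k≤n′) ⟩
        Q * ((2 * Q) ^ s * ∑ sides (λ g → (size (joined g) ∸ k) ^ s))
          ≤⟨ *-monoʳ-≤ Q (*-monoʳ-≤ ((2 * Q) ^ s) (∑-mono sides completions-lower)) ⟩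
        Q * ((2 * Q) ^ s * ∑ sides (λ g → ∑ (completions g) (λ _ → 1)))
          ≡⟨ cong (λ c → Q * ((2 * Q) ^ s * c))
               (≡.sym (trans (length≡∑1 embeddings) (∑-concatMap completions sides (λ _ → 1)))) ⟩
        Q * ((2 * Q) ^ s * length embeddings)
          ≡⟨ ≡.sym (*-assoc Q _ _) ⟩
        Q * (2 * Q) ^ s * length embeddings ∎
        where
        open ≤-Reasoning
        ℓ = length sides
        -- The same total also bounds the number of placements from below, because each contributes
        -- at most n.
        many-sides : n ^ t ≤ Q * ℓ
        many-sides = *-cancelˡ-≤ n {{>-nonZero 0<n}} (begin
          n * n ^ t                            ≤⟨ joined-total k≤n ⟩
          Q * ∑ sides (λ g → size (joined g))  ≤⟨ *-monoʳ-≤ Q (∑-mono sides (λ g → size≤n (joined g))) ⟩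
          Q * ∑ sides (λ _ → n)                ≡⟨ cong (Q *_) (∑-const sides n) ⟩
          Q * (ℓ * n)                          ≡⟨ assoc-comm Q ℓ n ⟩
          n * (Q * ℓ)                          ∎)
          where
          assoc-comm : ∀ a b c → a * (b * c) ≡ c * (a * b)
          assoc-comm = solve-∀

-- Rich edges and the final count

AllPairs-toList : {P : A → Set} {S : A → A → Set} {xs : List A} (ps : All P xs) →
  AllPairs S xs → AllPairs (S on proj₁) (All.toList ps)
AllPairs-toList []       []       = []
AllPairs-toList {P = P} {S} (p ∷ ps) (r ∷ rs) = go ps r ∷ AllPairs-toList ps rs
  where
  go : ∀ {x ys} (ps : All P ys) → All (S x) ys → All (λ b → S x (proj₁ b)) (All.toList ps)
  go []       []       = []
  go (_ ∷ ps) (r ∷ rs) = r ∷ go ps rs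

length-toList : {P : A → Set} {xs : List A} (ps : All P xs) → length (All.toList ps) ≡ length xs
length-toList []       = refl
length-toList (p ∷ ps) = cong suc (length-toList ps)

-- A vertex adjacent to j of the three contributes j on the left and 1 + C(j,2) on the right, and j
-- ≤ 1 + C(j,2).
degree-sum : (G : Graph n) (a b c : Fin n) →
  degree G a + degree G b + degree G c ≤ n + (codegree G a b + codegree G b c + codegree G a c)
degree-sum {n} G a b c = begin
  degree G a + degree G b + degree G c
    ≡⟨ ≡.sym (∑-+₃ (ind ∘ adj G a) (ind ∘ adj G b) (ind ∘ adj G c)) ⟩
  ∑ I (λ z → ind (adj G a z) + ind (adj G b z) + ind (adj G c z))
    ≤⟨ ∑-mono I (λ z → pairs (adj G a z) (adj G b z) (adj G c z)) ⟩
  ∑ I (λ z → 1 + (ind (adj G a z ∧ adj G b z) + ind (adj G b z ∧ adj G c z) + ind (adj G a z ∧ adj G c z)))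
    ≡⟨ ∑-+ I (λ _ → 1) _ ⟩
  ∑ I (λ _ → 1) + ∑ I (λ z → ind (adj G a z ∧ adj G b z) + ind (adj G b z ∧ adj G c z) + ind (adj G a z ∧ adj G c z))
    ≡⟨ cong₂ _+_ (trans (≡.sym (length≡∑1 I)) (length-allFin n)) (∑-+₃ _ _ _) ⟩
  n + (codegree G a b + codegree G b c + codegree G a c) ∎
  where
  open ≤-Reasoning
  I = allFin n
  ∑-+₃ : ∀ f g h → ∑ I (λ z → f z + g z + h z) ≡ ∑ I f + ∑ I g + ∑ I h
  ∑-+₃ f g h = trans (∑-+ I (λ z → f z + g z) h) (cong (_+ ∑ I h) (∑-+ I f g))
  pairs : ∀ p q r → ind p + ind q + ind r ≤ 1 + (ind (p ∧ q) + ind (q ∧ r) + ind (p ∧ r))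
  pairs true  true  true  = s≤s (s≤s (s≤s z≤n))
  pairs true  true  false = ≤-refl
  pairs true  false true  = ≤-refl
  pairs true  false false = ≤-refl
  pairs false true  true  = ≤-refl
  pairs false true  false = ≤-refl
  pairs false false true  = ≤-refl
  pairs false false false = z≤n

one-of-three : ∀ n K a b c → 3 * n ≤ K * (a + b + c) → n ≤ K * a ⊎ n ≤ K * b ⊎ n ≤ K * c
one-of-three n K a b c h with n ≤? K * a | n ≤? K * b | n ≤? K * c
... | yes p | _     | _     = inj₁ p
... | no _  | yes p | _     = inj₂ (inj₁ p)
... | no _  | no _  | yes p = inj₂ (inj₂ p)
... | no p  | no q  | no r  = contradiction h (<⇒≱ (begin-strict
  K * (a + b + c)         ≡⟨ distrib K a b c ⟩
  K * a + K * b + K * c   <⟨ +-mono-< (+-mono-< (≰⇒> p) (≰⇒> q)) (≰⇒> r) ⟩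
  n + n + n               ≡⟨ triple n ⟩
  3 * n                   ∎))
  where
  open ≤-Reasoning
  distrib : ∀ K a b c → K * (a + b + c) ≡ K * a + K * b + K * c
  distrib = solve-∀
  triple : ∀ n → n + n + n ≡ 3 * n
  triple = solve-∀

-- Each degree is at least n/3 + n/(3q), so by `degree-sum` the three codegrees sum to at least n/q.
triangle-rich : (G : Graph n) (q : ℕ) → (∀ z → suc q * n ≤ q * 3 * degree G z) → ∀ a b c →
  n ≤ q * 3 * codegree G a b ⊎ n ≤ q * 3 * codegree G b c ⊎ n ≤ q * 3 * codegree G a c
triangle-rich {n} G q mindeg a b c = one-of-three n (q * 3) _ _ _ (+-cancelˡ-≤ (q * 3 * n) _ _ (begin
  q * 3 * n + 3 * n
    ≡⟨ split q n ⟩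
  suc q * n + suc q * n + suc q * n
    ≤⟨ +-mono-≤ (+-mono-≤ (mindeg a) (mindeg b)) (mindeg c) ⟩
  q * 3 * degree G a + q * 3 * degree G b + q * 3 * degree G c
    ≡⟨ collect (q * 3) (degree G a) (degree G b) (degree G c) ⟩
  q * 3 * (degree G a + degree G b + degree G c)
    ≤⟨ *-monoʳ-≤ (q * 3) (degree-sum G a b c) ⟩
  q * 3 * (n + (codegree G a b + codegree G b c + codegree G a c))
    ≡⟨ *-distribˡ-+ (q * 3) n _ ⟩
  q * 3 * n + q * 3 * (codegree G a b + codegree G b c + codegree G a c) ∎))
  where
  open ≤-Reasoning
  split : ∀ q n → q * 3 * n + 3 * n ≡ suc q * n + suc q * n + suc q * n
  split = solve-∀
  collect : ∀ K a b c → K * a + K * b + K * c ≡ K * (a + b + c)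
  collect = solve-∀

module Counting {v} {H : Graph v} (bip : NearBipartition H)
  {a b c : Fin v} (a~b : Adj H a b) (b~c : Adj H b c) (a~c : Adj H a c) (q : ℕ) where
  open NearBipartition bip
  open Embeddings bip

  -- `n₀` exceeds every size requirement of `many-embeddings`, the successor giving 0 < n. `D` adds
  -- the constants of the cases n₀ ≤ n and n < n₀, so it serves both.
  K Q k n₀ D : ℕ
  K  = q * 3
  Q  = (2 * (K * K)) ^ t
  k  = 2 + v
  n₀ = suc (2 * (K * K) * k + 2 * Q * k)
  D  = Q * (2 * Q) ^ s + n₀ ^ (t + s)

  module _ {n} (G : Graph n) (mindeg : ∀ z → suc q * n ≤ K * degree G z) where

    -- The edge is kept as an edge ij of H, since `EdgeDisjoint` speaks of images of edges of H.
    record RichEdge (f : Fin v → Fin n) : Set where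
      field
        i j  : Fin v
        i~j  : Adj H i j
        rich : n ≤ K * codegree G (f i) (f j)

    rich-edge : ∀ f → RichEdge f
    rich-edge f with triangle-rich G q mindeg (f a) (f b) (f c)
    ... | inj₁ r        = record { i~j = a~b ; rich = r }
    ... | inj₂ (inj₁ r) = record { i~j = b~c ; rich = r }
    ... | inj₂ (inj₂ r) = record { i~j = a~c ; rich = r }

    open RichEdge

    left right : Copy H G → Fin n
    left  (f , _) = f (i (rich-edge f))
    right (f , _) = f (j (rich-edge f))

    left~right : ∀ c → Adj G (left c) (right c)
    left~right (f , _ , hom) = hom _ _ (i~j (rich-edge f))

    rooted : Copy H G → List (Fin v → Fin n)
    rooted c = At.embeddings G (left c) (right c)

    rooted-many : ∀ c → n₀ ≤ n → n ^ (t + s) ≤ Q * (2 * Q) ^ s * length (rooted c)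
    rooted-many c n₀≤n = At.many-embeddings G (left c) (right c) K
      -- `suc q * n` is `n + q * n`, so the sharp degree bound implies the weak one n ≤ K deg(z).
      (λ z → ≤-trans (m≤m+n n (q * n)) (mindeg z)) (rich (rich-edge (proj₁ c)))
      (≤-trans (s≤s z≤n) n₀≤n)
      (≤-trans (m≤n⇒m≤1+n (m≤m+n _ _)) n₀≤n)
      (≤-trans (m≤n⇒m≤1+n (m≤n+m _ _)) n₀≤n)

    -- Equal copies would share the image of the triangle edge ab.
    edgeDisjoint⇒distinct : ∀ {c d : Copy H G} → EdgeDisjoint {H = H} {G} c d → DistinctCopies {H = H} {G} c d
    edgeDisjoint⇒distinct disj e = disj (a , b , a , b , a~b , a~b , e a , e b)

    module _ (cs : List (Copy H G)) (disjoint : AllPairs (EdgeDisjoint {H = H} {G}) cs) where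

      maps : List (Fin v → Fin n)
      maps = concatMap rooted cs

      maps-copies : All (IsCopy H G) maps
      maps-copies = All-concatMap rooted
        (λ {c} _ → All.map proj₁ (At.embeddings-valid G (left c) (right c) (left~right c)))
        (All.universal (λ _ → refl {x = 0}) cs)

      -- The image of (x, y) reveals the rich edge at which a map is rooted, so equal maps from two
      -- source copies would give these a common edge.
      maps-distinct : AllPairs (λ f g → ¬ (∀ a → f a ≡ g a)) maps
      maps-distinct = AllPairs-concatMap
        (λ c f → f x ≡ left c × f y ≡ right c) rooted cs
        (λ c → All.map proj₂ (At.embeddings-valid G (left c) (right c) (left~right c)))
        (λ c → At.embeddings-differ G (left c) (right c))
        (λ {c} {d} disj (fx , fy) (gx , gy) e → disj
          (_ , _ , _ , _ , i~j (rich-edge (proj₁ c)) , i~j (rich-edge (proj₁ d)) ,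
           trans (≡.sym fx) (trans (e x) gx) , trans (≡.sym fy) (trans (e y) gy)))
        disjoint

      maps-many : n₀ ≤ n → length cs * n ^ (t + s) ≤ Q * (2 * Q) ^ s * length maps
      maps-many n₀≤n = begin
        length cs * n ^ (t + s)
          ≡⟨ ≡.sym (∑-const cs _) ⟩
        ∑ cs (λ _ → n ^ (t + s))
          ≤⟨ ∑-mono cs (λ c → rooted-many c n₀≤n) ⟩
        ∑ cs (λ c → Q * (2 * Q) ^ s * length (rooted c))
          ≡⟨ ∑-*ˡ cs (Q * (2 * Q) ^ s) _ ⟩
        Q * (2 * Q) ^ s * ∑ cs (λ c → length (rooted c))
          ≡⟨ cong (Q * (2 * Q) ^ s *_) (trans (∑-cong cs (λ c → length≡∑1 (rooted c)))
               (≡.sym (trans (length≡∑1 maps) (∑-concatMap rooted cs (λ _ → 1))))) ⟩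
        Q * (2 * Q) ^ s * length maps ∎
        where open ≤-Reasoning

      -- Below n₀ the given copies already suffice.
      many-copies : Σ (List (Copy H G)) λ ds → AllPairs (DistinctCopies {H = H} {G}) ds ×
        length cs * n ^ (t + s) ≤ D * length ds
      many-copies with n₀ ≤? n
      ... | yes n₀≤n = All.toList maps-copies , AllPairs-toList maps-copies maps-distinct , (begin
        length cs * n ^ (t + s)                     ≤⟨ maps-many n₀≤n ⟩
        Q * (2 * Q) ^ s * length maps               ≤⟨ *-monoˡ-≤ (length maps) (m≤m+n (Q * (2 * Q) ^ s) (n₀ ^ (t + s))) ⟩
        D * length maps                             ≡⟨ cong (D *_) (≡.sym (length-toList maps-copies)) ⟩
        D * length (All.toList maps-copies)         ∎)
        where open ≤-Reasoning
      ... | no n₀≰n = cs , AllPairs.map (λ {c} {d} → edgeDisjoint⇒distinct {c} {d}) disjoint , (begin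
        length cs * n ^ (t + s)     ≤⟨ *-monoʳ-≤ (length cs) (^-monoˡ-≤ (t + s) (<⇒≤ (≰⇒> n₀≰n))) ⟩
        length cs * n₀ ^ (t + s)    ≡⟨ *-comm (length cs) _ ⟩
        n₀ ^ (t + s) * length cs    ≤⟨ *-monoˡ-≤ (length cs) (m≤n+m (n₀ ^ (t + s)) (Q * (2 * Q) ^ s)) ⟩
        D * length cs               ∎)
        where open ≤-Reasoning

LinearCount : ∀ {v} → Graph v → (q r D : ℕ) → Set
LinearCount H q r D = ∀ {n} (G : Graph n) → (∀ z → suc q * n ≤ q * 3 * degree G z) →
  (cs : List (Copy H G)) → AllPairs (EdgeDisjoint {H = H} {G}) cs →
  Σ (List (Copy H G)) λ ds → AllPairs (DistinctCopies {H = H} {G}) ds × length cs * n ^ r ≤ D * length ds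

-- The equation 2 + r ≡ v, instead of r = v - 2, can be matched with `refl`, turning n^v into
-- n^(2+r).
linear-count : ∀ {v} {H : Graph v} → NearBipartition H → HasTriangle H → ∀ q →
  ∃[ r ] ∃[ D ] (2 + r ≡ v × LinearCount H q r D)
linear-count bip (_ , _ , _ , a~b , b~c , a~c) q =
  _ , Counting.D bip a~b b~c a~c q , Embeddings.2+[t+s]≡v bip , Counting.many-copies bip a~b b~c a~c q

-- The bipartition left by deleting a critical edge

nearBipartition : ∀ {v} (H : Graph v) → IsChromaticNumber H 3 →
  (∃[ x ] ∃[ y ] CriticalEdge H x y) → NearBipartition H
nearBipartition {v} H (col₃ , min₃) (x , y , x~y , k , j , (_ , k-min) , ((col , col-proper) , _) , j<k) = record
  { x = x ; y = y ; side = λ a → colour a ≠ᵇ colour x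
  ; x≢y = λ { refl → subst T (irrefl H x) x~y }
  ; side-x = ≡⇒≠ᵇ {colour x} refl
  ; side-y = ≡⇒≠ᵇ (≡.sym colour-x≡y)
  ; proper = λ a b a~b → Sum.map₂ (λ ne e → ne (≠ᵇ-cancel (colour a) (colour b) (colour x) e)) (colour-proper a b a~b)
  }
  where
  j≤2 : j ≤ 2
  -- `CriticalEdge` carries its own chromatic number k; minimality against the 3-colouring gives k ≤
  -- 3, so j < 3.
  j≤2 = s≤s⁻¹ (≤-trans j<k (k-min 3 col₃))
  colour : Fin v → Fin 2
  colour a = inject≤ (col a) j≤2
  _≠ᵇ_ : Fin 2 → Fin 2 → Bool
  b ≠ᵇ c = not (does (b ≟ c))
  ≡⇒≠ᵇ : ∀ {b c} → b ≡ c → b ≠ᵇ c ≡ false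
  ≡⇒≠ᵇ {b} {c} e = cong not (dec-true (b ≟ c) e)
  ≠ᵇ-cancel : ∀ a b c → a ≠ᵇ c ≡ b ≠ᵇ c → a ≡ b
  ≠ᵇ-cancel zero       zero       _          _ = refl
  ≠ᵇ-cancel (suc zero) (suc zero) _          _ = refl
  ≠ᵇ-cancel zero       (suc zero) zero       ()
  ≠ᵇ-cancel zero       (suc zero) (suc zero) ()
  ≠ᵇ-cancel (suc zero) zero       zero       ()
  ≠ᵇ-cancel (suc zero) zero       (suc zero) ()
  colour-proper : ∀ a b → Adj H a b → ((a ≡ x × b ≡ y) ⊎ (a ≡ y × b ≡ x)) ⊎ colour a ≢ colour b
  colour-proper a b a~b with (a ≟ x ×-dec b ≟ y) ⊎-dec (a ≟ y ×-dec b ≟ x)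
  ... | yes e = inj₁ e
  ... | no ne = inj₂ (λ e → col-proper a b (a~b , ne) (inject≤-injective j≤2 j≤2 (col a) (col b) e))
  -- Were x and y coloured differently, the colouring would be proper on xy too and H would be
  -- 2-colourable.
  colour-x≡y : colour x ≡ colour y
  colour-x≡y with colour x ≟ colour y
  ... | yes e = e
  ... | no ne = contradiction (min₃ 2 (colour , two-colouring)) (<⇒≱ ≤-refl)
    where
    two-colouring : ∀ a b → Adj H a b → colour a ≢ colour b
    two-colouring a b a~b e with colour-proper a b a~b
    ... | inj₁ (inj₁ (refl , refl)) = ne e
    ... | inj₁ (inj₂ (refl , refl)) = ne (≡.sym e)
    ... | inj₂ ne′ = ne′ e

-- Passing between rational and natural inequalities

open import Data.Integer using (+_; -[1+_])

toℚᵘ-ℕ→ℚ : ∀ a → ℚ.toℚᵘ (ℕ→ℚ a) ℚᵘ.≃ ℚᵘ.mkℚᵘ (+ a) 0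
toℚᵘ-ℕ→ℚ a = ℚ.toℚᵘ-fromℚᵘ (ℚᵘ.mkℚᵘ (+ a) 0)

ℕ→ℚ-* : ∀ a b → ℕ→ℚ (a * b) ≡ ℕ→ℚ a ℚ.* ℕ→ℚ b
ℕ→ℚ-* a b = ℚ.toℚᵘ-injective (begin
  ℚ.toℚᵘ (ℕ→ℚ (a * b))                        ≈⟨ toℚᵘ-ℕ→ℚ (a * b) ⟩
  ℚᵘ.mkℚᵘ (+ (a * b)) 0                       ≈⟨ ℚᵘ.≃-reflexive (cong (λ z → ℚᵘ.mkℚᵘ z 0) (ℤ.pos-* a b)) ⟩
  ℚᵘ.mkℚᵘ (+ a) 0 ℚᵘ.* ℚᵘ.mkℚᵘ (+ b) 0        ≈⟨ ℚᵘ.*-cong (ℚᵘ.≃-sym (toℚᵘ-ℕ→ℚ a)) (ℚᵘ.≃-sym (toℚᵘ-ℕ→ℚ b)) ⟩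
  ℚ.toℚᵘ (ℕ→ℚ a) ℚᵘ.* ℚ.toℚᵘ (ℕ→ℚ b)          ≈⟨ ℚᵘ.≃-sym (ℚ.toℚᵘ-homo-* (ℕ→ℚ a) (ℕ→ℚ b)) ⟩
  ℚ.toℚᵘ (ℕ→ℚ a ℚ.* ℕ→ℚ b)                    ∎)
  where open ℚᵘ.≃-Reasoning

ℕ→ℚ-mono : ∀ {a b} → a ≤ b → ℕ→ℚ a ℚ.≤ ℕ→ℚ b
ℕ→ℚ-mono {a} {b} a≤b = ℚ.toℚᵘ-cancel-≤
  (ℚᵘ.≤-respˡ-≃ (ℚᵘ.≃-sym (toℚᵘ-ℕ→ℚ a)) (ℚᵘ.≤-respʳ-≃ (ℚᵘ.≃-sym (toℚᵘ-ℕ→ℚ b))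
    (ℚᵘ.*≤* (ℤ.*-monoʳ-≤-nonNeg (+ 1) (ℤ.+≤+ a≤b)))))

reciprocal : ∀ d → (+ 1) / suc d ℚ.* ℕ→ℚ (suc d) ≡ ℚ.1ℚ
reciprocal d = ℚ.toℚᵘ-injective (begin
  ℚ.toℚᵘ ((+ 1) / suc d ℚ.* ℕ→ℚ (suc d))
    ≈⟨ ℚ.toℚᵘ-homo-* ((+ 1) / suc d) (ℕ→ℚ (suc d)) ⟩
  ℚ.toℚᵘ ((+ 1) / suc d) ℚᵘ.* ℚ.toℚᵘ (ℕ→ℚ (suc d))
    ≈⟨ ℚᵘ.*-cong (ℚ.toℚᵘ-fromℚᵘ (ℚᵘ.mkℚᵘ (+ 1) d)) (toℚᵘ-ℕ→ℚ (suc d)) ⟩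
  ℚᵘ.mkℚᵘ (+ 1) d ℚᵘ.* ℚᵘ.mkℚᵘ (+ suc d) 0
    ≈⟨ ℚᵘ.*≡* (cong +_ (unit d)) ⟩
  ℚᵘ.1ℚᵘ ∎)
  where
  open ℚᵘ.≃-Reasoning
  unit : ∀ d → (suc d + 0) * 1 ≡ suc d * 1 + 0
  unit = solve-∀

-- q is the denominator of γ, so the excess of 3γ over 1 is at least 1/q.
minDegree-ℕ : ∀ γ → (+ 1) / 3 ℚ.< γ →
  ∃[ q ] (∀ {n} (G : Graph n) → MinDegreeAtLeast G γ → ∀ z → suc q * n ≤ q * 3 * degree G z)
minDegree-ℕ (mkℚ (-[1+ _ ]) _ _) (ℚ.*<* ())
minDegree-ℕ γ@(mkℚ (+ p) d-1 _) (ℚ.*<* lt) = suc d-1 , bound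
  where
  q = suc d-1
  q<3p : suc q ≤ p * 3
  q<3p = ℤ.drop‿+<+ (subst₂ ℤ._<_ (ℤ.*-identityˡ (+ q)) (≡.sym (ℤ.pos-* p 3)) lt)
  bound : ∀ {n} (G : Graph n) → MinDegreeAtLeast G γ → ∀ z → suc q * n ≤ q * 3 * degree G z
  bound {n} G mindeg z = begin
    suc q * n                ≤⟨ *-monoˡ-≤ n q<3p ⟩
    p * 3 * n                ≡⟨ swap₁ p n ⟩
    3 * (p * n)              ≤⟨ *-monoʳ-≤ 3 pn≤qd ⟩
    3 * (q * degree G z)     ≡⟨ swap₂ q (degree G z) ⟩
    q * 3 * degree G z       ∎
    where
    open ≤-Reasoning
    swap₁ : ∀ p n → p * 3 * n ≡ 3 * (p * n)
    swap₁ = solve-∀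
    swap₂ : ∀ q d → 3 * (q * d) ≡ q * 3 * d
    swap₂ = solve-∀
    cleared : ℚᵘ.mkℚᵘ (+ p) d-1 ℚᵘ.* ℚᵘ.mkℚᵘ (+ n) 0 ℚᵘ.≤ ℚᵘ.mkℚᵘ (+ degree G z) 0
    cleared = ℚᵘ.≤-respʳ-≃ (toℚᵘ-ℕ→ℚ (degree G z))
      (ℚᵘ.≤-respˡ-≃ (ℚᵘ.≃-trans (ℚ.toℚᵘ-homo-* γ (ℕ→ℚ n)) (ℚᵘ.*-congˡ {ℚ.toℚᵘ γ} (toℚᵘ-ℕ→ℚ n)))
        (ℚ.toℚᵘ-mono-≤ (mindeg z)))
    pn≤qd : p * n ≤ q * degree G z
    pn≤qd with ℚᵘ.*≤* le ← cleared = ℤ.drop‿+≤+ (subst₂ ℤ._≤_ lhs rhs le)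
      where
      lhs : + p ℤ.* + n ℤ.* + 1 ≡ + (p * n)
      lhs = trans (ℤ.*-identityʳ _) (≡.sym (ℤ.pos-* p n))
      rhs : + degree G z ℤ.* + (q * 1) ≡ + (q * degree G z)
      rhs = trans (≡.sym (ℤ.pos-* (degree G z) (q * 1)))
        (cong +_ (trans (*-comm (degree G z) (q * 1)) (cong (_* degree G z) (*-identityʳ q))))

-- The denominator is d + 1 so that it is never zero; d L ≤ (d + 1) L absorbs the change.
clear-constant : ∀ d ε N a b L → ε ℚ.* ℕ→ℚ a ℚ.≤ ℕ→ℚ N → N * b ≤ d * L →
  (+ 1) / suc d ℚ.* ε ℚ.* ℕ→ℚ (a * b) ℚ.≤ ℕ→ℚ L
clear-constant d ε N a b L εa≤N Nb≤dL = begin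
  μ ℚ.* ε ℚ.* ℕ→ℚ (a * b)
    ≡⟨ ℚ.*-assoc μ ε _ ⟩
  μ ℚ.* (ε ℚ.* ℕ→ℚ (a * b))
    ≡⟨ cong (λ e → μ ℚ.* (ε ℚ.* e)) (ℕ→ℚ-* a b) ⟩
  μ ℚ.* (ε ℚ.* (ℕ→ℚ a ℚ.* ℕ→ℚ b))
    ≡⟨ cong (μ ℚ.*_) (≡.sym (ℚ.*-assoc ε (ℕ→ℚ a) (ℕ→ℚ b))) ⟩
  μ ℚ.* (ε ℚ.* ℕ→ℚ a ℚ.* ℕ→ℚ b)
    ≤⟨ ℚ.*-monoˡ-≤-nonNeg μ {{μ≥0}} (ℚ.*-monoʳ-≤-nonNeg (ℕ→ℚ b) {{ℚ.normalize-nonNeg b 1}} εa≤N) ⟩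
  μ ℚ.* (ℕ→ℚ N ℚ.* ℕ→ℚ b)
    ≡⟨ cong (μ ℚ.*_) (≡.sym (ℕ→ℚ-* N b)) ⟩
  μ ℚ.* ℕ→ℚ (N * b)
    ≤⟨ ℚ.*-monoˡ-≤-nonNeg μ {{μ≥0}} (ℕ→ℚ-mono (≤-trans Nb≤dL (m≤n+m (d * L) L))) ⟩
  μ ℚ.* ℕ→ℚ (suc d * L)
    ≡⟨ cong (μ ℚ.*_) (ℕ→ℚ-* (suc d) L) ⟩
  μ ℚ.* (ℕ→ℚ (suc d) ℚ.* ℕ→ℚ L)
    ≡⟨ ≡.sym (ℚ.*-assoc μ (ℕ→ℚ (suc d)) (ℕ→ℚ L)) ⟩
  μ ℚ.* ℕ→ℚ (suc d) ℚ.* ℕ→ℚ L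
    ≡⟨ cong (ℚ._* ℕ→ℚ L) (reciprocal d) ⟩
  ℚ.1ℚ ℚ.* ℕ→ℚ L
    ≡⟨ ℚ.*-identityˡ _ ⟩
  ℕ→ℚ L ∎
  where
  open ℚ.≤-Reasoning
  μ : ℚ
  μ = (+ 1) / suc d
  μ≥0 : ℚ.NonNegative μ
  μ≥0 = ℚ.normalize-nonNeg 1 (suc d)

-- Linear removal for every γ above 1/3

threshold : ∀ {v} (H : Graph v) (γ : ℚ) →
  (∃[ q ] (∀ {n} (G : Graph n) → MinDegreeAtLeast G γ → ∀ z → suc q * n ≤ q * 3 * degree G z)) →
  (∀ q → ∃[ r ] ∃[ D ] (2 + r ≡ v × LinearCount H q r D)) →
  LinearRemovalThreshold H γ
-- `D` is fixed before ε, n and G are given, so μ = 1/(D + 1) is uniform in them.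
threshold H γ (q , mindeg-ℕ) counts with r , D , refl , count ← counts q =
  (+ 1) / suc D , ℚ.positive⁻¹ _ {{ℚ.normalize-pos 1 (suc D)}} , removal
  where
  removal : LinearRemovalAt H γ ((+ 1) / suc D)
  removal ε _ n G mindeg (cs , disjoint , εn²≤)
    with ds , ds-distinct , bound ← count G (mindeg-ℕ G mindeg) cs disjoint =
    ds , ds-distinct ,
    -- Of n^(2+r), the factor n² is absorbed by the hypothesis on `cs` and n^r by `bound`.
    subst (λ e → (+ 1) / suc D ℚ.* ε ℚ.* ℕ→ℚ e ℚ.≤ ℕ→ℚ (length ds)) (≡.sym (^-distribˡ-+-* n 2 r))
      (clear-constant D ε (length cs) (n ^ 2) (n ^ r) (length ds) εn²≤ bound)

theorem5p4 : ∀ {v : ℕ} (H : Graph v) → IsChromaticNumber H 3 →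
    (∃[ x ] ∃[ y ] CriticalEdge H x y) → HasTriangle H →
    LinRemAtMost H ((+ 1) / 3)
theorem5p4 H χ≡3 critical tri γ γ>⅓ =
  threshold H γ (minDegree-ℕ γ γ>⅓) (linear-count (nearBipartition H χ≡3 critical) tri)
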